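{- Let $p\ge2$ be an integer, $r\in\{0,\dots,p-1\}$, $f=\sum_{i=0}^da_ix^i\in\mathbb{Z}_p[x]$ (with the convention $0^0:=1$), regarded as a function $\mathbb{Z}_p\to\mathbb{Z}_p$, and $k\ge0$ an integer. Then: (1) $f$ is weakly $(p,r)$-suitable at $k$. (2) If $k\le1$, then $f$ is $(p,r)$-suitable at $k$. (3) If $k\ge2$, then $f$ is $(p,r)$-suitable at $k$ if and only if $\gcd(p,f'(r)\,\%\,p)=1$, where $f'(r)\,\%\,p=\left(\sum_{i=1}^d(a_i\%p)\,i\,r^{i-1}\right)\%\,p$. In particular, if $k\ge 2$ and $a_0,a_2,\dots,a_d$ are given, then the set of all $a_1\in\mathbb{Z}_p$ that make $f$ $(p,r)$-suitable at $k$ is $$\left\{\left(a-\sum_{i=2}^d(a_i\%p)\,i\,r^{i-1}\right)\%\,p\ \middle|\ a\in\{0,\dots,p-1\},\ \gcd(p,a)=1\right\}+p\mathbb{Z}_p.$$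
   Context: $p\ge2$ is an integer, not necessarily prime. $\mathbb{Z}_p=\varprojlim \mathbb{Z}/p^k\mathbb{Z}$; every $a\in\mathbb{Z}_p$ is uniquely $a=\sum_{i\ge0}a_ip^i$ with $a_i\in\{0,\dots,p-1\}$, and $a\,\%\,p:=a_0$ (for integers, the usual remainder in $\{0,\dots,p-1\}$). A function $f:\mathbb{Z}_p\to\mathbb{Z}_p$ is weakly $(p,r)$-suitable at $k$ if for all $m,n\in r+p\mathbb{Z}_p$: $m\equiv n\pmod{p^k}$ implies $f(m)-(f(m)\%p)\equiv f(n)-(f(n)\%p)\pmod{p^k}$; it is $(p,r)$-suitable at $k$ if this implication is an equivalence for all $m,n\in r+p\mathbb{Z}_p$. $f'$ denotes the formal derivative. -}

module Defs where

open import Algebra.Bundles using (CommutativeRing; Semiring)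
import Algebra.Definitions.RawMonoid as RawMonoidDefs
import Algebra.Definitions.RawSemiring as RawSemiringDefs
import Algebra.Properties.Semiring.Exp as Exp
import Algebra.Properties.Monoid.Sum as MonoidSum
open import Data.Fin.Base using (toℕ; suc)
open import Data.Integer.Base as ℤ using (ℤ; +_; _%ℕ_)
open import Data.Integer.Divisibility.Signed as ℤ using () renaming (_∣_ to _∣ℤ_)
import Data.Integer.Properties as ℤ
open import Data.Integer.Tactic.RingSolver using (solve-∀)
open import Data.Nat.Base as ℕ using (ℕ; suc; NonZero; NonTrivial)
import Data.Nat.Properties as ℕ
open import Data.Product.Base using (∃; _,_)
open import Data.Vec.Functional using (Vector)
open import Function.Bundles using (Func; _⇔_)
open import Level using (0ℓ)
open import Relation.Binary.PropositionalEquality.Core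
  using (_≡_; refl; subst)
open import Relation.Unary using (Pred; _∈_)

infixl 10 sumℕ-syntax

sumℕ-syntax : ∀ n → Vector ℕ n → ℕ
sumℕ-syntax _ = RawMonoidDefs.sum ℕ.+-0-rawMonoid

syntax sumℕ-syntax n (λ j → x) = ∑[ j < n ] x

module Padic (p : ℕ) .{{_ : NonTrivial p}} where

  instance
    p-nonZero : NonZero p
    p-nonZero = ℕ.nonTrivial⇒nonZero p

  -- Congruence of integers; ℤ under this relation is the setoid ℤ/pᵏℤ.
  infix 4 _≡ℤ_[mod-p^_]
  _≡ℤ_[mod-p^_] : ℤ → ℤ → ℕ → Set
  x ≡ℤ y [mod-p^ k ] = + (p ℕ.^ k) ∣ℤ x ℤ.- y

  -- An element of lim ℤ/pᵏℤ: one residue class mod pᵏ for every k (given by an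
  -- integer representative), compatible with the projections
  -- ℤ/pᵏ⁺¹ℤ → ℤ/pᵏℤ.  Choice of representatives is quotiented out by _≈_.
  record ℤₚ : Set where
    no-eta-equality
    constructor mkℤₚ
    field
      res    : ℕ → ℤ
      compat : ∀ k → res (suc k) ≡ℤ res k [mod-p^ k ]
  open ℤₚ public

  infix 4 _≈_
  record _≈_ (a b : ℤₚ) : Set where
    no-eta-equality
    constructor mk≈
    field
      at : ∀ k → res a k ≡ℤ res b k [mod-p^ k ]
  open _≈_ public

  private
    module _ {d : ℤ} where
      ≡⇒∣ : ∀ {x y} → x ≡ y → d ∣ℤ x ℤ.- y
      ≡⇒∣ {x} refl = ℤ.divides (+ 0) (ℤ.+-inverseʳ x)

      ∣-sym : ∀ x y → d ∣ℤ x ℤ.- y → d ∣ℤ y ℤ.- x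
      ∣-sym x y h = subst (d ∣ℤ_) (lemma x y) (ℤ.∣m⇒∣-m h)
        where lemma : ∀ x y → ℤ.- (x ℤ.- y) ≡ y ℤ.- x
              lemma = solve-∀

      ∣-trans : ∀ x y z → d ∣ℤ x ℤ.- y → d ∣ℤ y ℤ.- z → d ∣ℤ x ℤ.- z
      ∣-trans x y z h i = subst (d ∣ℤ_) (lemma x y z) (ℤ.∣m∣n⇒∣m+n h i)
        where lemma : ∀ x y z → (x ℤ.- y) ℤ.+ (y ℤ.- z) ≡ x ℤ.- z
              lemma = solve-∀

      ∣-+ : ∀ x y u v → d ∣ℤ x ℤ.- y → d ∣ℤ u ℤ.- v → d ∣ℤ (x ℤ.+ u) ℤ.- (y ℤ.+ v)
      ∣-+ x y u v h i = subst (d ∣ℤ_) (lemma x y u v) (ℤ.∣m∣n⇒∣m+n h i)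
        where lemma : ∀ x y u v → (x ℤ.- y) ℤ.+ (u ℤ.- v) ≡ (x ℤ.+ u) ℤ.- (y ℤ.+ v)
              lemma = solve-∀

      ∣-* : ∀ x y u v → d ∣ℤ x ℤ.- y → d ∣ℤ u ℤ.- v → d ∣ℤ (x ℤ.* u) ℤ.- (y ℤ.* v)
      ∣-* x y u v h i = subst (d ∣ℤ_) (lemma x y u v)
          (ℤ.∣m∣n⇒∣m+n (ℤ.∣m⇒∣m*n u h) (ℤ.∣n⇒∣m*n y i))
        where lemma : ∀ x y u v → (x ℤ.- y) ℤ.* u ℤ.+ y ℤ.* (u ℤ.- v)
                                ≡ (x ℤ.* u) ℤ.- (y ℤ.* v)
              lemma = solve-∀

      ∣-neg : ∀ x y → d ∣ℤ x ℤ.- y → d ∣ℤ (ℤ.- x) ℤ.- (ℤ.- y)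
      ∣-neg x y h = subst (d ∣ℤ_) (lemma x y) (ℤ.∣m⇒∣-m h)
        where lemma : ∀ x y → ℤ.- (x ℤ.- y) ≡ (ℤ.- x) ℤ.- (ℤ.- y)
              lemma = solve-∀

  ι : ℤ → ℤₚ
  ι x .res    _ = x
  ι x .compat _ = ≡⇒∣ {x = x} refl

  infixl 6 _+ₚ_
  infixl 7 _*ₚ_
  infix  8 -ₚ_

  _+ₚ_ : ℤₚ → ℤₚ → ℤₚ
  (a +ₚ b) .res    k = res a k ℤ.+ res b k
  (a +ₚ b) .compat k = ∣-+ (res a (suc k)) (res a k) _ _ (compat a k) (compat b k)

  _*ₚ_ : ℤₚ → ℤₚ → ℤₚ
  (a *ₚ b) .res    k = res a k ℤ.* res b k
  (a *ₚ b) .compat k =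
    ∣-* (res a (suc k)) (res a k) (res b (suc k)) (res b k) (compat a k) (compat b k)

  -ₚ_ : ℤₚ → ℤₚ
  (-ₚ a) .res    k = ℤ.- res a k
  (-ₚ a) .compat k = ∣-neg (res a (suc k)) (res a k) (compat a k)

  private
    pointwise : ∀ {a b} → (∀ k → res a k ≡ res b k) → a ≈ b
    pointwise a≡b = mk≈ λ k → ≡⇒∣ (a≡b k)

  ℤₚ-commutativeRing : CommutativeRing 0ℓ 0ℓ
  ℤₚ-commutativeRing = record
    { Carrier = ℤₚ
    ; _≈_ = _≈_
    ; _+_ = _+ₚ_
    ; _*_ = _*ₚ_
    ; -_ = -ₚ_
    ; 0# = ι (+ 0)
    ; 1# = ι (+ 1)
    ; isCommutativeRing = record
      { isRing = record
        { +-isAbelianGroup = record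
          { isGroup = record
            { isMonoid = record
              { isSemigroup = record
                { isMagma = record
                  { isEquivalence = record
                    { refl = pointwise λ _ → refl
                    ; sym = λ {a} {b} h → mk≈ λ k → ∣-sym (res a k) (res b k) (at h k)
                    ; trans = λ {a} {b} {c} h i → mk≈ λ k →
                        ∣-trans (res a k) (res b k) (res c k) (at h k) (at i k)
                    }
                  ; ∙-cong = λ {a} {b} {c} {d} h i → mk≈ λ k →
                      ∣-+ (res a k) (res b k) (res c k) (res d k) (at h k) (at i k)
                  }
                ; assoc = λ a b c → pointwise λ k → ℤ.+-assoc (res a k) (res b k) (res c k)
                }
              ; identity = (λ a → pointwise λ k → ℤ.+-identityˡ (res a k))
                         , (λ a → pointwise λ k → ℤ.+-identityʳ (res a k))
              }
            ; inverse = (λ a → pointwise λ k → ℤ.+-inverseˡ (res a k))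
                      , (λ a → pointwise λ k → ℤ.+-inverseʳ (res a k))
            ; ⁻¹-cong = λ {a} {b} h → mk≈ λ k → ∣-neg (res a k) (res b k) (at h k)
            }
          ; comm = λ a b → pointwise λ k → ℤ.+-comm (res a k) (res b k)
          }
        ; *-cong = λ {a} {b} {c} {d} h i → mk≈ λ k →
            ∣-* (res a k) (res b k) (res c k) (res d k) (at h k) (at i k)
        ; *-assoc = λ a b c → pointwise λ k → ℤ.*-assoc (res a k) (res b k) (res c k)
        ; *-identity = (λ a → pointwise λ k → ℤ.*-identityˡ (res a k))
                     , (λ a → pointwise λ k → ℤ.*-identityʳ (res a k))
        ; distrib = (λ a b c → pointwise λ k → ℤ.*-distribˡ-+ (res a k) (res b k) (res c k))
                  , (λ a b c → pointwise λ k → ℤ.*-distribʳ-+ (res a k) (res b k) (res c k))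
        }
      ; *-comm = λ a b → pointwise λ k → ℤ.*-comm (res a k) (res b k)
      }
    }

  private
    module R = CommutativeRing ℤₚ-commutativeRing
  open R using (_+_; _*_; _-_; setoid)
  open RawSemiringDefs (Semiring.rawSemiring R.semiring)
    using (_∣_; _^_; sum) renaming (_×_ to _·_)

  infix 4 _≡_[mod-p^_]
  _≡_[mod-p^_] : ℤₚ → ℤₚ → ℕ → Set
  m ≡ n [mod-p^ k ] = ι (+ (p ℕ.^ k)) ∣ m - n

  infix 5 _+pℤₚ
  _+pℤₚ : ℤₚ → Pred ℤₚ 0ℓ
  (c +pℤₚ) m = ∃ λ z → m ≈ c + ι (+ p) * z

  -- The coefficient aᵢ ∈ {0,…,p−1} in a = Σ aᵢpⁱ.  The class of a mod pⁱ⁺¹ has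
  -- least nonnegative representative a₀ + a₁p + ⋯ + aᵢpⁱ.
  digit : ℤₚ → ℕ → ℕ
  digit a i = (res a (suc i) %ℕ (p ℕ.^ suc i)) ℕ./ (p ℕ.^ i)
    where instance
      _ = ℕ.m^n≢0 p i
      _ = ℕ.m^n≢0 p (suc i)

  infixl 8 _%p
  _%p : ℤₚ → ℕ
  a %p = digit a 0

  WeaklySuitable : ℕ → Func setoid setoid → ℕ → Set
  WeaklySuitable r f k = ∀ m n → m ∈ ι (+ r) +pℤₚ → n ∈ ι (+ r) +pℤₚ →
    m ≡ n [mod-p^ k ] →
    to m - ι (+ (to m %p)) ≡ to n - ι (+ (to n %p)) [mod-p^ k ]
    where open Func f using (to)

  Suitable : ℕ → Func setoid setoid → ℕ → Set
  Suitable r f k = ∀ m n → m ∈ ι (+ r) +pℤₚ → n ∈ ι (+ r) +pℤₚ →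
    m ≡ n [mod-p^ k ] ⇔
    to m - ι (+ (to m %p)) ≡ to n - ι (+ (to n %p)) [mod-p^ k ]
    where open Func f using (to)

  -- Σ_{i<n} aᵢxⁱ as its vector of coefficients (a₀,…,aₙ₋₁).
  Poly : ℕ → Set
  Poly = Vector ℤₚ

  eval : ∀ {n} → Poly n → ℤₚ → ℤₚ
  eval a x = sum λ i → a i * x ^ toℕ i

  ⟦_⟧ : ∀ {n} → Poly n → Func setoid setoid
  ⟦_⟧ {n} a = record
    { to   = eval a
    ; cong = λ x≈y → MonoidSum.sum-cong-≋ R.+-monoid {n}
        λ i → R.*-cong (R.refl {a i}) (Exp.^-congˡ R.semiring (toℕ i) x≈y)
    }

  derivative : ∀ {n} → Poly (suc n) → Poly n
  derivative a j = suc (toℕ j) · a (suc j)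

{-# OPTIONS --safe #-}
module Submission where

-- On r + pℤₚ one has f(m) − f(n) = (m − n) q with q ≡ f′(r) mod p.  Hence f(m) % p
-- is constant there, and (weak) suitability at k compares m ≡ n with f(m) ≡ f(n)
-- mod pᵏ.  If f′(r) is prime to p, then q is a unit mod pᵏ and the two agree;
-- otherwise a common factor g of p and f′(r) gives r and r + pᵏ⁻¹(p/g) the same
-- value mod pᵏ as soon as k ≥ 2.  All congruences are read off on integer residues.

open import Defs
open import Algebra.Bundles using (CommutativeRing; Semiring)
open import Algebra.Definitions.RawMagma using (_,_)
import Algebra.Definitions.RawSemiring as RawSemiringDefs
open import Data.Fin.Base using (Fin; toℕ; zero; suc)
open import Data.Integer.Base as ℤ using (ℤ; +_; -_; _-_; _%ℕ_; ∣_∣)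
open import Data.Integer.Divisibility.Signed as ℤ
  using (divides; ∣ᵤ⇒∣; ∣⇒∣ᵤ; ∣m∣n⇒∣m+n; ∣m∣n⇒∣m-n; ∣m⇒∣-m; ∣m⇒∣m*n; ∣n⇒∣m*n)
  renaming (_∣_ to _∣ℤ_)
import Data.Integer.Coprimality as ℤ using (coprime-divisor)
import Data.Integer.DivMod as ℤ using (a≡a%ℕn+[a/ℕn]*n; n%ℕd<d)
import Data.Integer.Properties as ℤ
open import Data.Integer.Tactic.RingSolver using (solve-∀)
open import Data.Nat.Base as ℕ
  using (ℕ; zero; suc; _+_; _*_; _^_; _≤_; _<_; _%_; s≤s; NonZero; NonTrivial)
open import Data.Nat.Coprimality
  using (Coprime; coprime-divisor; gcd≡1⇒coprime; 1-coprimeTo)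
import Data.Nat.Divisibility as ℕ
import Data.Nat.DivMod as ℕ
open import Data.Nat.GCD using (gcd; gcd[m,n]∣m; gcd[m,n]∣n)
import Data.Nat.Properties as ℕ
open import Data.Product.Base using (_×_; _,_; ∃-syntax)
open import Data.Vec.Functional using (Vector; _∷_)
open import Function.Base using (_∘_)
open import Function.Bundles using (_⇔_; mk⇔; module Equivalence)
open import Function.Construct.Composition using (_⇔-∘_)
open import Relation.Binary.PropositionalEquality
  using (_≡_; refl; sym; trans; cong; cong₂; subst; subst₂; module ≡-Reasoning)
open import Relation.Unary using (_∈_)

-- Congruences between integers.

infix 4 _≋_[mod_]
-- A record rather than a synonym for divisibility: `x` and `y` can then be inferred from the type,
-- whereas they cannot be recovered from an unfolded difference.
record _≋_[mod_] (x y d : ℤ) : Set where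
  constructor ∣⇒≋
  field ≋⇒∣ : d ∣ℤ x - y
open _≋_[mod_]

module _ {d : ℤ} where

  mod-reflexive : ∀ {x y} → x ≡ y → x ≋ y [mod d ]
  mod-reflexive {x} refl = ∣⇒≋ (divides (+ 0) (ℤ.+-inverseʳ x))

  mod-sym : ∀ {x y} → x ≋ y [mod d ] → y ≋ x [mod d ]
  mod-sym {x} {y} (∣⇒≋ h) = ∣⇒≋ (subst (d ∣ℤ_) (identity x y) (∣m⇒∣-m h))
    where identity : ∀ x y → - (x - y) ≡ y - x
          identity = solve-∀

  mod-trans : ∀ {x y z} → x ≋ y [mod d ] → y ≋ z [mod d ] → x ≋ z [mod d ]
  mod-trans {x} {y} {z} (∣⇒≋ h) (∣⇒≋ i) = ∣⇒≋ (subst (d ∣ℤ_) (identity x y z) (∣m∣n⇒∣m+n h i))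
    where identity : ∀ x y z → (x - y) ℤ.+ (y - z) ≡ x - z
          identity = solve-∀

  +-cong-mod : ∀ {x y u v} → x ≋ y [mod d ] → u ≋ v [mod d ] → x ℤ.+ u ≋ y ℤ.+ v [mod d ]
  +-cong-mod {x} {y} {u} {v} (∣⇒≋ h) (∣⇒≋ i) =
    ∣⇒≋ (subst (d ∣ℤ_) (identity x y u v) (∣m∣n⇒∣m+n h i))
    where identity : ∀ x y u v → (x - y) ℤ.+ (u - v) ≡ (x ℤ.+ u) - (y ℤ.+ v)
          identity = solve-∀

  *-cong-mod : ∀ {x y u v} → x ≋ y [mod d ] → u ≋ v [mod d ] → x ℤ.* u ≋ y ℤ.* v [mod d ]
  *-cong-mod {x} {y} {u} {v} (∣⇒≋ h) (∣⇒≋ i) =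
    ∣⇒≋ (subst (d ∣ℤ_) (identity x y u v) (∣m∣n⇒∣m+n (∣m⇒∣m*n u h) (∣n⇒∣m*n y i)))
    where identity : ∀ x y u v → (x - y) ℤ.* u ℤ.+ y ℤ.* (u - v) ≡ (x ℤ.* u) - (y ℤ.* v)
          identity = solve-∀

  ^-cong-mod : ∀ {x y} n → x ≋ y [mod d ] → x ℤ.^ n ≋ y ℤ.^ n [mod d ]
  ^-cong-mod zero    h = mod-reflexive refl
  ^-cong-mod (suc n) h = *-cong-mod h (^-cong-mod n h)

  ∣-resp-mod : ∀ {x y} → x ≋ y [mod d ] → d ∣ℤ x → d ∣ℤ y
  ∣-resp-mod {x} {y} (∣⇒≋ h) i = subst (d ∣ℤ_) (identity x y) (∣m∣n⇒∣m-n i h)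
    where identity : ∀ x y → x - (x - y) ≡ y
          identity = solve-∀

  -- The quotient is the sum of xⁱ yⁿ⁻ⁱ over i ≤ n, built recursively by q ↦ x q + yⁿ⁺¹. Each of its
  -- n + 1 terms is cⁿ mod d.
  difference-of-powers : ∀ {c x y} → x ≋ c [mod d ] → y ≋ c [mod d ] → ∀ n →
    ∃[ q ] (x ℤ.^ suc n) - (y ℤ.^ suc n) ≡ (x - y) ℤ.* q × q ≋ + suc n ℤ.* c ℤ.^ n [mod d ]
  difference-of-powers {c} {x} {y} x≡c y≡c zero =
    + 1 , identity x y , mod-reflexive refl
    where identity : ∀ x y → x ℤ.* + 1 - y ℤ.* + 1 ≡ (x - y) ℤ.* + 1
          identity = solve-∀
  difference-of-powers {c} {x} {y} x≡c y≡c (suc n)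
    with q , eq , q≡ ← difference-of-powers x≡c y≡c n =
      x ℤ.* q ℤ.+ y ℤ.^ suc n
    , (begin
        x ℤ.* (x ℤ.^ suc n) - y ℤ.* (y ℤ.^ suc n)
          ≡⟨ split x y (x ℤ.^ suc n) (y ℤ.^ suc n) ⟩
        x ℤ.* ((x ℤ.^ suc n) - (y ℤ.^ suc n)) ℤ.+ (x - y) ℤ.* (y ℤ.^ suc n)
          ≡⟨ cong (λ z → x ℤ.* z ℤ.+ (x - y) ℤ.* (y ℤ.^ suc n)) eq ⟩
        x ℤ.* ((x - y) ℤ.* q) ℤ.+ (x - y) ℤ.* (y ℤ.^ suc n)
          ≡⟨ collect x y q (y ℤ.^ suc n) ⟩
        (x - y) ℤ.* (x ℤ.* q ℤ.+ y ℤ.^ suc n)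
          ∎)
    , mod-trans (+-cong-mod (*-cong-mod x≡c q≡) (^-cong-mod (suc n) y≡c))
        (mod-reflexive (trans (leibniz c (+ suc n) (c ℤ.^ n))
          (cong (ℤ._* c ℤ.^ suc n) (sym (ℤ.pos-+ 1 (suc n))))))
    where
    open ≡-Reasoning
    split : ∀ x y u v → x ℤ.* u - y ℤ.* v ≡ x ℤ.* (u - v) ℤ.+ (x - y) ℤ.* v
    split = solve-∀
    collect : ∀ x y q v → x ℤ.* ((x - y) ℤ.* q) ℤ.+ (x - y) ℤ.* v ≡ (x - y) ℤ.* (x ℤ.* q ℤ.+ v)
    collect = solve-∀
    leibniz : ∀ c n u → c ℤ.* (n ℤ.* u) ℤ.+ c ℤ.* u ≡ (+ 1 ℤ.+ n) ℤ.* (c ℤ.* u)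
    leibniz = solve-∀

mod-coarsen : ∀ {d e x y} → d ∣ℤ e → x ≋ y [mod e ] → x ≋ y [mod d ]
mod-coarsen d∣e (∣⇒≋ h) = ∣⇒≋ (ℤ.∣-trans d∣e h)

%ℕ-mod : ∀ x d .{{_ : NonZero d}} → x ≋ + (x %ℕ d) [mod + d ]
%ℕ-mod x d = ∣⇒≋ (divides (x ℤ./ℕ d) (trans
  (cong (_- + (x %ℕ d)) (ℤ.a≡a%ℕn+[a/ℕn]*n x d))
  (identity (+ (x %ℕ d)) ((x ℤ./ℕ d) ℤ.* + d))))
  where identity : ∀ u v → (u ℤ.+ v) - u ≡ v
        identity = solve-∀

-- The distance between m and n is at most their maximum, hence below d, and the only multiple of d
-- below d is 0.
residue-unique : ∀ {d m n} → m < d → n < d → + m ≋ + n [mod + d ] → m ≡ n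
residue-unique {d} {m} {n} m<d n<d (∣⇒≋ h) = ℤ.+-injective
  (ℤ.i-j≡0⇒i≡j (+ m) (+ n) (ℤ.∣i∣≡0⇒i≡0 (small-multiple bound (∣⇒∣ᵤ h))))
  where
  small-multiple : ∀ {l} → l < d → d ℕ.∣ l → l ≡ 0
  small-multiple {zero}  _   _   = refl
  small-multiple {suc l} l<d d∣l with () ← ℕ.<⇒≱ l<d (ℕ.∣⇒≤ d∣l)
  bound : ∣ + m - + n ∣ < d
  bound = ℕ.≤-<-trans (ℕ.≤-trans (ℕ.≤-reflexive (cong ∣_∣ (ℤ.m-n≡m⊖n m n))) (ℤ.∣m⊝n∣≤m⊔n m n))
    (ℕ.⊔-lub m<d n<d)

-- Powers and coprimality.

pos-^ : ∀ m n → + (m ^ n) ≡ (+ m) ℤ.^ n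
pos-^ m zero    = refl
pos-^ m (suc n) = trans (ℤ.pos-* m (m ^ n)) (cong (+ m ℤ.*_) (pos-^ m n))

-- A common divisor e of m · mᵏ and n is coprime to m, since it divides n. Euclid's lemma then moves
-- e into mᵏ.
coprime-^ : ∀ {m n} k → Coprime m n → Coprime (m ^ k) n
coprime-^ zero    c {e} = 1-coprimeTo _
coprime-^ (suc k) c {e} (e∣m^ , e∣n) = coprime-^ k c
  (coprime-divisor (λ (i∣e , i∣m) → c (i∣m , ℕ.∣-trans i∣e e∣n)) e∣m^ , e∣n)

-- A common divisor of m and x also divides n, because x and n agree modulo it.
coprime-mod : ∀ {m n x} → x ≋ + n [mod + m ] → Coprime m n → Coprime m ∣ x ∣
coprime-mod x≡n c {e} (e∣m , e∣x) = c
  (e∣m , ∣⇒∣ᵤ (∣-resp-mod (mod-coarsen {+ e} (∣ᵤ⇒∣ e∣m) x≡n) (∣ᵤ⇒∣ e∣x)))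

-- Residues of p-adic integers.

module _ (p : ℕ) .{{_ : NonTrivial p}} where
  open Padic p
  private
    module R = CommutativeRing ℤₚ-commutativeRing
  open RawSemiringDefs (Semiring.rawSemiring R.semiring)
    using (sum) renaming (_∣_ to _∣ₚ_; _×_ to _·_; _^_ to _^ₚ_)

  at≋ : ∀ {a b} → a ≈ b → ∀ k → res a k ≋ res b k [mod + (p ^ k) ]
  at≋ {a} {b} a≈b k = ∣⇒≋ {res a k} {res b k} (at a≈b k)

  res-· : ∀ n a k → res (n · a) k ≡ + n ℤ.* res a k
  res-· zero    a k = refl
  res-· (suc n) a k = trans (cong (λ z → res a k ℤ.+ z) (res-· n a k))
    (trans (identity (res a k) (+ n)) (cong (ℤ._* res a k) (sym (ℤ.pos-+ 1 n))))
    where identity : ∀ x n → x ℤ.+ n ℤ.* x ≡ (+ 1 ℤ.+ n) ℤ.* x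
          identity = solve-∀

  res-^ : ∀ a n k → res (a ^ₚ n) k ≡ res a k ℤ.^ n
  res-^ a zero    k = refl
  res-^ a (suc n) k = cong (res a k ℤ.*_) (res-^ a n k)

  p∣p^1+ : ∀ k → + p ∣ℤ + (p ^ suc k)
  p∣p^1+ k = ∣ᵤ⇒∣ (ℕ.m∣m*n (p ^ k))

  p^0∣ : ∀ x → + (p ^ 0) ∣ℤ x
  p^0∣ x = divides x (sym (ℤ.*-identityʳ x))

  p∣⇒p^1∣ : ∀ {x} → + p ∣ℤ x → + (p ^ 1) ∣ℤ x
  p∣⇒p^1∣ {x} = subst (λ q → + q ∣ℤ x) (sym (ℕ.*-identityʳ p))

  res-coherent : ∀ a j k → res a (j + k) ≋ res a k [mod + (p ^ k) ]
  res-coherent a zero    k = mod-reflexive refl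
  res-coherent a (suc j) k = mod-trans
    (mod-coarsen (∣ᵤ⇒∣ (subst (p ^ k ℕ.∣_) (sym (ℕ.^-distribˡ-+-* p j k)) (ℕ.n∣m*n (p ^ j))))
      (∣⇒≋ (compat a (j + k))))
    (res-coherent a j k)

  -- The digit `_%p` is read at level 1; this carries congruences mod p between that level and any
  -- other positive one.
  res-mod-p : ∀ a k → res a (suc k) ≋ res a 1 [mod + p ]
  res-mod-p a k = subst (λ n → res a n ≋ res a 1 [mod + p ]) (ℕ.+-comm k 1)
    (mod-coarsen (p∣p^1+ 0) (res-coherent a k 1))

  ≡ₚ⇒res : ∀ {m n} k → m ≡ n [mod-p^ k ] → res m k ≋ res n k [mod + (p ^ k) ]
  ≡ₚ⇒res k (q , eq) = ∣⇒≋ (∣-resp-mod (at≋ eq k) (∣n⇒∣m*n (res q k) ℤ.∣-refl))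

  -- The quotient of a by pᵏ has as its residue mod pʲ the quotient of the residue
  -- of a mod pʲ⁺ᵏ.
  res∣⇒∣ₚ : ∀ a k → + (p ^ k) ∣ℤ res a k → ι (+ (p ^ k)) ∣ₚ a
  res∣⇒∣ₚ a k h = mkℤₚ quot (λ j → ≋⇒∣ (quot-coherent j)) , mk≈ quot-at
    where
    P∣res : ∀ j → + (p ^ k) ∣ℤ res a (j + k)
    P∣res j = ∣-resp-mod (mod-sym (res-coherent a j k)) h
    quot : ℕ → ℤ
    quot j = ℤ.quotient (P∣res j)
    quot-eq : ∀ j → res a (j + k) ≡ quot j ℤ.* + (p ^ k)
    quot-eq j = ℤ._∣_.equality (P∣res j)
    identity : ∀ u v w → u ℤ.* w - v ℤ.* w ≡ (u - v) ℤ.* w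
    identity = solve-∀
    quot-coherent : ∀ j → quot (suc j) ≋ quot j [mod + (p ^ j) ]
    -- Compatibility of `a` at level j + k says that pʲ pᵏ divides the difference of consecutive
    -- quotients times pᵏ; cancel pᵏ.
    quot-coherent j = ∣⇒≋ (ℤ.*-cancelʳ-∣ (+ (p ^ k)) {{ℕ.m^n≢0 p k}} (subst₂ _∣ℤ_
      (trans (cong +_ (ℕ.^-distribˡ-+-* p j k)) (ℤ.pos-* (p ^ j) (p ^ k)))
      (trans (cong₂ _-_ (quot-eq (suc j)) (quot-eq j)) (identity (quot (suc j)) (quot j) (+ (p ^ k))))
      (compat a (j + k))))
    quot-at : ∀ j → + (p ^ j) ∣ℤ quot j ℤ.* + (p ^ k) - res a j
    -- Coherence with j and k exchanged: the residue at level k + j, which is the quotient times pᵏ,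
    -- is compared mod pʲ with the one at level j.
    quot-at j = subst (λ x → + (p ^ j) ∣ℤ x - res a j)
      (trans (cong (res a) (ℕ.+-comm k j)) (quot-eq j))
      (≋⇒∣ (res-coherent a k j))

  res⇒≡ₚ : ∀ {m n} k → res m k ≋ res n k [mod + (p ^ k) ] → m ≡ n [mod-p^ k ]
  res⇒≡ₚ {m} {n} k (∣⇒≋ h) = res∣⇒∣ₚ (m R.- n) k h

  -- Cosets of pℤₚ and the lowest digit.

  ∈coset⇒res : ∀ {c m} k → m ∈ c +pℤₚ → res m (suc k) ≋ res c (suc k) [mod + p ]
  -- The level is `suc k` because equality in ℤₚ says nothing at level 0, where the modulus is 1.
  ∈coset⇒res {c} {m} k (z , eq) = mod-trans (mod-coarsen (p∣p^1+ k) (at≋ eq (suc k)))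
    (∣⇒≋ (subst (+ p ∣ℤ_) (identity (res c (suc k)) (+ p) (res z (suc k))) (∣m⇒∣m*n (res z (suc k)) ℤ.∣-refl)))
    where identity : ∀ c p z → p ℤ.* z ≡ (c ℤ.+ p ℤ.* z) - c
          identity = solve-∀

  ≡ₚ⇒∈coset : ∀ {c m} → m ≡ c [mod-p^ 1 ] → m ∈ c +pℤₚ
  ≡ₚ⇒∈coset {c} {m} (z , eq) = z , mk≈ λ k → subst (+ (p ^ k) ∣ℤ_)
      (trans (cong (λ q → (res m k - res c k) - res z k ℤ.* + q) (ℕ.*-identityʳ p))
             (identity (res m k) (res c k) (res z k) (+ p)))
      (≋⇒∣ (mod-sym (at≋ {z R.* ι (+ (p ^ 1))} {m R.- c} eq k)))
    where identity : ∀ m c z p → (m - c) - z ℤ.* p ≡ m - (c ℤ.+ p ℤ.* z)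
          identity = solve-∀

  res⇒∈coset : ∀ {c m} → res m 1 ≋ res c 1 [mod + p ] → m ∈ c +pℤₚ
  res⇒∈coset (∣⇒≋ h) = ≡ₚ⇒∈coset (res⇒≡ₚ 1 (∣⇒≋ (p∣⇒p^1∣ h)))

  -- By definition the digit is a remainder mod `p ^ 1` divided by `p ^ 0`, so the division by 1 has
  -- to be removed first.
  res≡%p : ∀ a → res a 1 ≋ + (a %p) [mod + p ]
  res≡%p a = subst (λ n → res a 1 ≋ + n [mod + p ]) (sym (ℕ.n/1≡n _))
    (mod-coarsen (p∣p^1+ 0) (%ℕ-mod (res a 1) (p ^ 1) {{ℕ.m^n≢0 p 1}}))

  %p<p : ∀ a → a %p < p
  %p<p a = subst (_< p) (sym (ℕ.n/1≡n _))
    (subst (_%ℕ_ (res a 1) (p ^ 1) {{ℕ.m^n≢0 p 1}} <_) (ℕ.*-identityʳ p) (ℤ.n%ℕd<d (res a 1) (p ^ 1) {{ℕ.m^n≢0 p 1}}))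

  %p-unique : ∀ a {n} → n < p → res a 1 ≋ + n [mod + p ] → a %p ≡ n
  %p-unique a n<p h = residue-unique (%p<p a) n<p (mod-trans (mod-sym (res≡%p a)) h)

  -- Factoring m - n out of f(m) - f(n).

  sum-difference : ∀ {d n} D k (f g h : Vector ℤₚ n) →
    (∀ i → ∃[ q ] res (f i) k - res (g i) k ≡ D ℤ.* q × q ≋ res (h i) k [mod d ]) →
    ∃[ q ] res (sum f) k - res (sum g) k ≡ D ℤ.* q × q ≋ res (sum h) k [mod d ]
  sum-difference {n = zero} D k f g h H = + 0 , sym (ℤ.*-zeroʳ D) , mod-reflexive refl
  sum-difference {n = suc n} D k f g h H
    with q , eq , q≡ ← H zero
       | s , es , s≡ ← sum-difference D k (f ∘ suc) (g ∘ suc) (h ∘ suc) (H ∘ suc) =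
      q ℤ.+ s
    , trans (interchange (res (f zero) k) (res (g zero) k) (res (sum (f ∘ suc)) k) (res (sum (g ∘ suc)) k))
        (trans (cong₂ ℤ._+_ eq es) (sym (ℤ.*-distribˡ-+ D q s)))
    , +-cong-mod q≡ s≡
    where interchange : ∀ x y u v → (x ℤ.+ u) - (y ℤ.+ v) ≡ (x - y) ℤ.+ (u - v)
          interchange = solve-∀

  -- The constant term cancels. Every other monomial factors by `difference-of-powers`, and its
  -- quotient is the matching term of the derivative mod p.
  eval-difference : ∀ {d} (a : Poly (suc d)) c k {m n} →
    res m k ≋ c [mod + p ] → res n k ≋ c [mod + p ] →
    ∃[ q ] res (eval a m) k - res (eval a n) k ≡ (res m k - res n k) ℤ.* q
         × q ≋ res (eval (derivative a) (ι c)) k [mod + p ]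
  eval-difference a c k {m} {n} m≡c n≡c =
    let q , eq , q≡ = sum-difference (res m k - res n k) k
          (λ i → a (suc i) R.* m ^ₚ suc (toℕ i)) (λ i → a (suc i) R.* n ^ₚ suc (toℕ i))
          (λ i → derivative a i R.* ι c ^ₚ toℕ i) monomial
    in q , trans (cancel (res (a zero) k) _ _) eq , q≡
    where
    cancel : ∀ w x y → (w ℤ.* + 1 ℤ.+ x) - (w ℤ.* + 1 ℤ.+ y) ≡ x - y
    cancel = solve-∀
    factor : ∀ w x y → w ℤ.* x - w ℤ.* y ≡ w ℤ.* (x - y)
    factor = solve-∀
    swap : ∀ w x y → w ℤ.* (x ℤ.* y) ≡ x ℤ.* (w ℤ.* y)
    swap = solve-∀
    assoc : ∀ w x y → w ℤ.* (x ℤ.* y) ≡ (x ℤ.* w) ℤ.* y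
    assoc = solve-∀
    monomial : ∀ i → ∃[ q ]
      res (a (suc i)) k ℤ.* res (m ^ₚ suc (toℕ i)) k - res (a (suc i)) k ℤ.* res (n ^ₚ suc (toℕ i)) k
        ≡ (res m k - res n k) ℤ.* q
      × q ≋ res (derivative a i R.* ι c ^ₚ toℕ i) k [mod + p ]
    monomial i with q , eq , q≡ ← difference-of-powers m≡c n≡c (toℕ i) =
        w ℤ.* q
      , trans (factor w _ _) (trans
          (cong (w ℤ.*_) (trans
            (cong₂ _-_ (res-^ m (suc (toℕ i)) k) (res-^ n (suc (toℕ i)) k)) eq))
          (swap w (res m k - res n k) q))
      , mod-trans (*-cong-mod (mod-reflexive {x = w} refl) q≡) (mod-reflexive (trans
          (assoc w (+ suc (toℕ i)) (c ℤ.^ toℕ i))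
          (sym (cong₂ ℤ._*_ (res-· (suc (toℕ i)) (a (suc i)) k) (res-^ (ι c) (toℕ i) k)))))
      where w = res (a (suc i)) k

  sum-mod : ∀ {d n} k (f : Vector ℤₚ n) (g : Vector ℕ n) →
    (∀ i → res (f i) k ≋ + g i [mod d ]) → res (sum f) k ≋ + (∑[ i < n ] g i) [mod d ]
  sum-mod {n = zero}  k f g H = mod-reflexive refl
  sum-mod {n = suc n} k f g H =
    mod-trans (+-cong-mod (H zero) (sum-mod k (f ∘ suc) (g ∘ suc) (H ∘ suc)))
      (mod-reflexive (sym (ℤ.pos-+ (g zero) _)))

  -- The derivative at r modulo p.

  module _ (r : ℕ) where

    derivative-mod : ∀ {d} (a : Poly (suc d)) →
      res (eval (derivative a) (ι (+ r))) 1
        ≋ + (∑[ j < d ] (a (suc j) %p * suc (toℕ j) * r ^ toℕ j)) [mod + p ]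
    derivative-mod a = sum-mod 1 _ _ λ j → let i = toℕ j; α = a (suc j) in
      mod-trans
        (mod-reflexive (cong₂ ℤ._*_ (trans (res-· (suc i) α 1) (ℤ.*-comm (+ suc i) (res α 1)))
                                    (trans (res-^ (ι (+ r)) i 1) (sym (pos-^ r i)))))
        (mod-trans
          (*-cong-mod (*-cong-mod (res≡%p α) (mod-reflexive {x = + suc i} refl))
                      (mod-reflexive {x = + (r ^ i)} refl))
          (mod-reflexive (sym (trans (ℤ.pos-* (α %p * suc i) (r ^ i))
            (cong (ℤ._* + (r ^ i)) (ℤ.pos-* (α %p) (suc i)))))))

    derivative-%p : ∀ {d} (a : Poly (suc d)) →
      eval (derivative a) (ι (+ r)) %p
        ≡ (∑[ j < d ] (a (suc j) %p * suc (toℕ j) * r ^ toℕ j)) % p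
    derivative-%p a = %p-unique (eval (derivative a) (ι (+ r))) (ℕ.m%n<n _ p)
      (mod-trans (derivative-mod a) (%ℕ-mod (+ _) p))

    -- Suitability on the coset of r.

    module _ {d : ℕ} (a : Poly (suc d)) where

      private
        f : ℤₚ → ℤₚ
        f = eval a

        f′[r] : ℤₚ
        f′[r] = eval (derivative a) (ι (+ r))

      -- The quotient varies with m and n, but its class mod p does not, so whether it is prime to p
      -- depends on f′(r) alone.
      eval-mean-value : ∀ k {m n} → m ∈ ι (+ r) +pℤₚ → n ∈ ι (+ r) +pℤₚ →
        ∃[ q ] res (f m) (suc k) - res (f n) (suc k) ≡ (res m (suc k) - res n (suc k)) ℤ.* q
             × q ≋ + (f′[r] %p) [mod + p ]
      eval-mean-value k {m} {n} m∈ n∈ =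
        let q , eq , q≡ = eval-difference a (+ r) (suc k) {m} {n}
              (∈coset⇒res {ι (+ r)} k m∈) (∈coset⇒res {ι (+ r)} k n∈)
        in q , eq , mod-trans q≡ (mod-trans (res-mod-p f′[r] k) (res≡%p f′[r]))

      -- The factorisation is an equality of integers, so any modulus is allowed: p yields the
      -- constant lowest digit, pᵏ⁺¹ yields weak suitability.
      eval-cong-mod : ∀ k {m n} → m ∈ ι (+ r) +pℤₚ → n ∈ ι (+ r) +pℤₚ → ∀ {e} →
        res m (suc k) ≋ res n (suc k) [mod e ] → res (f m) (suc k) ≋ res (f n) (suc k) [mod e ]
      eval-cong-mod k m∈ n∈ {e} (∣⇒≋ h) =
        let q , eq , _ = eval-mean-value k m∈ n∈
        in ∣⇒≋ (subst (e ∣ℤ_) (sym eq) (∣m⇒∣m*n q h))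

      eval-%p-constant : ∀ {m n} → m ∈ ι (+ r) +pℤₚ → n ∈ ι (+ r) +pℤₚ → f m %p ≡ f n %p
      eval-%p-constant {m} {n} m∈ n∈ = %p-unique (f m) (%p<p (f n)) (mod-trans
        (eval-cong-mod 0 m∈ n∈ (mod-trans (∈coset⇒res 0 m∈) (mod-sym (∈coset⇒res 0 n∈))))
        (res≡%p (f n)))

      -- The subtracted digits f(m) % p and f(n) % p coincide, so they can be dropped.
      suitable-condition : ∀ k {m n} → m ∈ ι (+ r) +pℤₚ → n ∈ ι (+ r) +pℤₚ →
        (f m R.- ι (+ (f m %p))) ≡ (f n R.- ι (+ (f n %p))) [mod-p^ k ]
          ⇔ res (f m) k ≋ res (f n) k [mod + (p ^ k) ]
      suitable-condition k {m} {n} m∈ n∈ = mk⇔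
        (λ h → ∣⇒≋ (subst (+ (p ^ k) ∣ℤ_) shift (≋⇒∣ (≡ₚ⇒res k h))))
        (λ h → res⇒≡ₚ k (∣⇒≋ (subst (+ (p ^ k) ∣ℤ_) (sym shift) (≋⇒∣ h))))
        where
        identity : ∀ x y c → (x - c) - (y - c) ≡ x - y
        identity = solve-∀
        shift : (res (f m) k - + (f m %p)) - (res (f n) k - + (f n %p)) ≡ res (f m) k - res (f n) k
        shift = trans
          (cong (λ c → (res (f m) k - + c) - (res (f n) k - + (f n %p))) (eval-%p-constant m∈ n∈))
          (identity (res (f m) k) (res (f n) k) (+ (f n %p)))

      weaklySuitable : ∀ k → WeaklySuitable r ⟦ a ⟧ k
      -- The factorisation exists only at positive levels; at level 0 the modulus is 1 and
      -- everything is congruent.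
      weaklySuitable zero    m n m∈ n∈ h = res⇒≡ₚ 0 (∣⇒≋ (p^0∣ _))
      weaklySuitable (suc k) m n m∈ n∈ h = Equivalence.from (suitable-condition (suc k) m∈ n∈)
        (eval-cong-mod k m∈ n∈ (≡ₚ⇒res (suc k) h))

      -- Any two elements of the coset are already congruent mod p, so the converse implication
      -- holds trivially.
      suitable-≤1 : ∀ {k} → k ≤ 1 → Suitable r ⟦ a ⟧ k
      suitable-≤1 {zero}      _ m n m∈ n∈ =
        mk⇔ (weaklySuitable 0 m n m∈ n∈) (λ _ → res⇒≡ₚ 0 (∣⇒≋ (p^0∣ _)))
      suitable-≤1 {suc zero}  _ m n m∈ n∈ =
        mk⇔ (weaklySuitable 1 m n m∈ n∈) (λ _ → res⇒≡ₚ 1 (∣⇒≋ (p∣⇒p^1∣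
          (≋⇒∣ (mod-trans (∈coset⇒res 0 m∈) (mod-sym (∈coset⇒res 0 n∈)))))))
      suitable-≤1 {suc (suc _)} (s≤s ())

      -- The quotient q is congruent to f′(r) mod p, hence prime to pᵏ⁺¹; if pᵏ⁺¹ divides (m - n) q,
      -- it divides m - n.
      coprime⇒suitable : ∀ k → gcd p (f′[r] %p) ≡ 1 → Suitable r ⟦ a ⟧ (suc k)
      coprime⇒suitable k gcd≡1 m n m∈ n∈ = mk⇔ (weaklySuitable (suc k) m n m∈ n∈) λ h →
        let q , eq , q≡ = eval-mean-value k m∈ n∈
            D = res m (suc k) - res n (suc k)
        in res⇒≡ₚ (suc k) (∣⇒≋ (∣ᵤ⇒∣ (ℤ.coprime-divisor (+ (p ^ suc k)) q D
             (coprime-^ (suc k) (coprime-mod q≡ (gcd≡1⇒coprime gcd≡1)))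
             (∣⇒∣ᵤ (subst (+ (p ^ suc k) ∣ℤ_) (trans eq (ℤ.*-comm D q))
               (≋⇒∣ (Equivalence.to (suitable-condition (suc k) m∈ n∈) h)))))))

      -- If g = gcd(p, f′(r)) and p = t g, then f takes r and r + pᵏ⁺¹ t to values
      -- congruent mod pᵏ⁺², so suitability forces p ∣ t, that is g = 1.
      suitable⇒coprime : ∀ k → Suitable r ⟦ a ⟧ (suc (suc k)) → gcd p (f′[r] %p) ≡ 1
      suitable⇒coprime k S = ℕ.∣1⇒≡1 (ℕ.*-cancelˡ-∣ t
          (subst₂ ℕ._∣_ (ℕ.m∣n⇒n≡quotient*m g∣p) (sym (ℕ.*-identityʳ t)) p∣t))
        where
        g P : ℕ
        g = gcd p (f′[r] %p)
        P = p ^ suc k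
        g∣p : g ℕ.∣ p
        g∣p = gcd[m,n]∣m p (f′[r] %p)
        t : ℕ
        t = ℕ.quotient g∣p
        instance
          t-nonZero : NonZero t
          t-nonZero = ℕ.quotient≢0 g∣p
        m n : ℤₚ
        m = ι (+ r ℤ.+ + P ℤ.* + t)
        n = ι (+ r)
        offset : ∀ x y → y ≡ (x ℤ.+ y) - x
        offset = solve-∀
        m∈ : m ∈ ι (+ r) +pℤₚ
        -- This needs p to divide P = pᵏ⁺¹, which is where a level of at least 2 enters.
        m∈ = res⇒∈coset (∣⇒≋ (subst (+ p ∣ℤ_) (offset (+ r) (+ P ℤ.* + t)) (∣m⇒∣m*n (+ t) (p∣p^1+ k))))
        n∈ : n ∈ ι (+ r) +pℤₚ
        n∈ = res⇒∈coset (mod-reflexive refl)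
        f[m]≡f[n] : res (f m) (suc (suc k)) ≋ res (f n) (suc (suc k)) [mod + (p * P) ]
        -- The difference of the values is P t q. Since g divides both p and the digit of f′(r), it
        -- divides q, so P t g = p P divides the difference.
        f[m]≡f[n] = let q , eq , q≡ = eval-mean-value (suc k) m∈ n∈ in
          ∣⇒≋ (subst (+ (p * P) ∣ℤ_) (sym eq) (subst₂ _∣ℤ_
            (trans (cong (ℤ._* + g) (sym (ℤ.pos-* P t))) (trans (sym (ℤ.pos-* (P * t) g)) (cong +_
              (trans (ℕ.*-assoc P t g) (trans (cong (P *_) (sym (ℕ.m∣n⇒n≡quotient*m g∣p)))
                (ℕ.*-comm P p))))))
            (cong (ℤ._* q) (offset (+ r) (+ P ℤ.* + t)))
            (ℤ.*-monoʳ-∣ (+ P ℤ.* + t)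
              (∣-resp-mod (mod-sym (mod-coarsen (∣ᵤ⇒∣ g∣p) q≡))
                (∣ᵤ⇒∣ (gcd[m,n]∣n p (f′[r] %p)))))))
        p∣t : p ℕ.∣ t
        -- Suitability turns the congruence of values into p P ∣ m - n = P t; cancel P.
        p∣t = ℕ.*-cancelˡ-∣ P {{ℕ.m^n≢0 p (suc k)}} (subst₂ ℕ._∣_ (ℕ.*-comm p P)
          (trans (cong ∣_∣ (sym (offset (+ r) (+ P ℤ.* + t)))) (cong ∣_∣ (sym (ℤ.pos-* P t))))
          (∣⇒∣ᵤ (≋⇒∣ (≡ₚ⇒res {m} {n} (suc (suc k)) (Equivalence.from (S m n m∈ n∈)
            (Equivalence.from (suitable-condition (suc (suc k)) m∈ n∈) f[m]≡f[n]))))))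

      suitable⇔coprime : ∀ {k} → 2 ≤ k → Suitable r ⟦ a ⟧ k ⇔ gcd p (f′[r] %p) ≡ 1
      suitable⇔coprime {suc (suc k)} _ = mk⇔ (suitable⇒coprime k) (coprime⇒suitable (suc k))
      suitable⇔coprime {suc zero} (s≤s ())

    -- The admissible linear coefficients.

    linear-coefficients : ∀ {e} (a₀ a₁ : ℤₚ) (as : Poly e) →
      let s = ∑[ j < e ] (as j %p * suc (suc (toℕ j)) * r ^ suc (toℕ j)) in
      gcd p (eval (derivative (a₀ ∷ a₁ ∷ as)) (ι (+ r)) %p) ≡ 1
        ⇔ (∃[ b ] b < p × gcd p b ≡ 1 × a₁ ∈ ι (+ ((+ b - + s) %ℕ p)) +pℤₚ)
    linear-coefficients {e} a₀ a₁ as = mk⇔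
      -- The witness b is the digit of f′(r) itself.
      (λ gcd≡1 → f′[r] %p , %p<p f′[r] , gcd≡1 , res⇒∈coset
        (mod-trans
          (∣⇒≋ (subst (+ p ∣ℤ_) (identity (res a₁ 1) (+ s) (+ (f′[r] %p)))
            (≋⇒∣ (mod-trans (mod-sym f′[r]-mod) (res≡%p f′[r])))))
          (%ℕ-mod (+ (f′[r] %p) - + s) p)))
      (λ (b , b<p , gcd≡1 , a₁∈) → trans
        (cong (gcd p) (%p-unique f′[r] b<p (mod-trans f′[r]-mod
          (∣⇒≋ (subst (+ p ∣ℤ_) (sym (identity (res a₁ 1) (+ s) (+ b)))
            (≋⇒∣ (mod-trans (∈coset⇒res 0 a₁∈) (mod-sym (%ℕ-mod (+ b - + s) p)))))))))
        gcd≡1)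
      where
      f′[r] : ℤₚ
      f′[r] = eval (derivative (a₀ ∷ a₁ ∷ as)) (ι (+ r))
      s : ℕ
      s = ∑[ j < e ] (as j %p * suc (suc (toℕ j)) * r ^ suc (toℕ j))
      identity : ∀ x s b → (x ℤ.+ s) - b ≡ x - (b - s)
      identity = solve-∀
      -- Only the linear term involves `a₁`, and it contributes its digit times 1 times r⁰. Hence
      -- f′(r) ≡ b exactly when `a₁` ≡ b - s mod p; this difference may be negative, so its
      -- remainder is taken in ℤ.
      f′[r]-mod : res f′[r] 1 ≋ res a₁ 1 ℤ.+ + s [mod + p ]
      f′[r]-mod = mod-trans (derivative-mod (a₀ ∷ a₁ ∷ as)) (mod-trans
        (mod-reflexive (trans (ℤ.pos-+ (a₁ %p * 1 * 1) s)
          (cong (λ n → + n ℤ.+ + s) (trans (ℕ.*-identityʳ _) (ℕ.*-identityʳ _)))))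
        (+-cong-mod (mod-sym (res≡%p a₁)) (mod-reflexive refl)))

theorem4p8 : ∀ (p : ℕ) .{{_ : NonTrivial p}} (r : Fin p) (k : ℕ) →
    let open Padic p in
    (∀ (d : ℕ) (a : Poly (suc d)) →
    WeaklySuitable (toℕ r) ⟦ a ⟧ k
    × (k ≤ 1 → Suitable (toℕ r) ⟦ a ⟧ k)
    × (2 ≤ k →
    (Suitable (toℕ r) ⟦ a ⟧ k ⇔ gcd p (eval (derivative a) (ι (+ toℕ r)) %p) ≡ 1)
    × eval (derivative a) (ι (+ toℕ r)) %p
    ≡ (∑[ j < d ] (a (suc j) %p * suc (toℕ j) * toℕ r ^ toℕ j)) % p))
    × (2 ≤ k → ∀ (e : ℕ) (a₀ : ℤₚ) (as : Poly e) (a₁ : ℤₚ) →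
    Suitable (toℕ r) ⟦ a₀ ∷ a₁ ∷ as ⟧ k
    ⇔ (∃[ b ] b < p × gcd p b ≡ 1 ×
    a₁ ∈ ι (+ ((+ b - + (∑[ j < e ] (as j %p * suc (suc (toℕ j)) * toℕ r ^ suc (toℕ j)))) %ℕ p)) +pℤₚ))
theorem4p8 p r k =
    (λ d a → weaklySuitable p (toℕ r) a k
           , suitable-≤1 p (toℕ r) a
           , λ 2≤k → suitable⇔coprime p (toℕ r) a 2≤k , derivative-%p p (toℕ r) a)
  , λ 2≤k e a₀ as a₁ →
      linear-coefficients p (toℕ r) a₀ a₁ as ⇔-∘ suitable⇔coprime p (toℕ r) (a₀ ∷ a₁ ∷ as) 2≤k
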